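{- Let $1\le k<n$ and let $T\in\mathcal{T}_{k,n}$ be a tableau. Then there is a unique multiset $\varphi_{NN}(T)$ of vectors in $V^*_{k,n}$ whose summing tableau is $T$ and whose elements are pairwise nonnesting, and there is a unique multiset $\varphi_{NC}(T)$ of vectors in $V^*_{k,n}$ whose summing tableau is $T$ and whose elements are pairwise noncrossing.
   Context: $V_{k,n}$ is the set of strictly increasing vectors $(i_1,\dots,i_k)$ with entries in $[n]$, and $V^*_{k,n}=V_{k,n}\setminus\{(n-k+1,\dots,n)\}$. A tableau of shape $k\times(n-k)$ is a matrix $T=(t_{ab})\in\mathbb{N}^{k\times(n-k)}$ (rows $a\in[k]$ indexed from top to bottom, columns $b\in[n-k]$) that is weakly increasing along rows from left to right ($t_{a,b}\le t_{a,b+1}$) and along columns from bottom to top ($t_{a+1,b}\le t_{a,b}$); $\mathcal{T}_{k,n}$ is the set of these. The summing tableau of a finite multiset $L$ of vectors $(i_{1j},\dots,i_{kj})$, $j\in[\ell]$, of $V_{k,n}$ is $t_{ab}=\#\{j\in[\ell]: i_{aj}\le a+b-1\}$ (counted with multiplicity). Two arcs $(p<p')$, $(q<q')$ nest if $p<q<q'<p'$ or $q<p<p'<q'$, and cross if $p<q<p'<q'$ or $q<p<q'<p'$. $I,J\in V_{k,n}$ are nonnesting if for all $1\le a<b\le k$ the arcs $(i_a<i_b)$ and $(j_a<j_b)$ do not nest; they are noncrossing if for all $1\le a<b\le k$ with $i_\ell=j_\ell$ for all $a<\ell<b$ these arcs do not cross. (Equal vectors are both nonnesting and noncrossing.) 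-}

module Defs where

open import Data.Nat using (ℕ; zero; suc; _+_; _∸_; _≤_; _<_; _≤?_)
open import Data.Fin using (Fin; toℕ)
open import Data.Vec using (Vec; lookup)
open import Data.List using (List; length; filter)
open import Data.List.Membership.Propositional using (_∈_)
open import Data.List.Relation.Binary.Permutation.Propositional using (_↭_)
open import Data.Product using (_×_; Σ)
open import Data.Sum using (_⊎_)
open import Relation.Nullary using (¬_)
open import Relation.Binary.PropositionalEquality using (_≡_)

-- Vectors (i_1,…,i_k) are elements of Vec ℕ k; index a : Fin k stands for a = toℕ a + 1.

InV : (k n : ℕ) → Vec ℕ k → Set
InV k n v =
  (∀ (a : Fin k) → 1 ≤ lookup v a × lookup v a ≤ n) ×
  (∀ (a b : Fin k) → toℕ a < toℕ b → lookup v a < lookup v b)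

IsTop : (k n : ℕ) → Vec ℕ k → Set
IsTop k n v = ∀ (a : Fin k) → lookup v a ≡ (n ∸ k) + suc (toℕ a)

InV* : (k n : ℕ) → Vec ℕ k → Set
InV* k n v = InV k n v × ¬ IsTop k n v

-- tableaux of shape k × (n-k): rows a (top to bottom), columns b
Tableau : ℕ → ℕ → Set
Tableau k n = Fin k → Fin (n ∸ k) → ℕ

IsTableau : (k n : ℕ) → Tableau k n → Set
IsTableau k n T =
  (∀ (a : Fin k) (b b' : Fin (n ∸ k)) → toℕ b' ≡ suc (toℕ b) → T a b ≤ T a b') ×
  (∀ (a a' : Fin k) (b : Fin (n ∸ k)) → toℕ a' ≡ suc (toℕ a) → T a' b ≤ T a b)

-- summing tableau of a multiset (list) L: with 1-based a = toℕ a + 1, b = toℕ b + 1,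
-- t_ab = #{ j : i_{a j} ≤ a + b - 1 } = #{ j : i_{a j} ≤ toℕ a + toℕ b + 1 }
summing : (k n : ℕ) → List (Vec ℕ k) → Tableau k n
summing k n L a b = length (filter (λ v → lookup v a ≤? suc (toℕ a + toℕ b)) L)

Nest : ℕ → ℕ → ℕ → ℕ → Set
Nest p p' q q' = (p < q × q < q' × q' < p') ⊎ (q < p × p < p' × p' < q')

Cross : ℕ → ℕ → ℕ → ℕ → Set
Cross p p' q q' = (p < q × q < p' × p' < q') ⊎ (q < p × p < q' × q' < p')

Nonnesting : (k : ℕ) → Vec ℕ k → Vec ℕ k → Set
Nonnesting k I J = ∀ (a b : Fin k) → toℕ a < toℕ b →
  ¬ Nest (lookup I a) (lookup I b) (lookup J a) (lookup J b)

Noncrossing : (k : ℕ) → Vec ℕ k → Vec ℕ k → Set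
Noncrossing k I J = ∀ (a b : Fin k) → toℕ a < toℕ b →
  (∀ (l : Fin k) → toℕ a < toℕ l → toℕ l < toℕ b → lookup I l ≡ lookup J l) →
  ¬ Cross (lookup I a) (lookup I b) (lookup J a) (lookup J b)

Pairwise : {k : ℕ} → (Vec ℕ k → Vec ℕ k → Set) → List (Vec ℕ k) → Set
Pairwise R L = ∀ I J → I ∈ L → J ∈ L → R I J

Good : (k n : ℕ) → (Vec ℕ k → Vec ℕ k → Set) → Tableau k n → List (Vec ℕ k) → Set
Good k n R T L =
  (∀ v → v ∈ L → InV* k n v) ×
  (∀ a b → summing k n L a b ≡ T a b) ×
  Pairwise R L

UniqueMultiset : {k : ℕ} → (List (Vec ℕ k) → Set) → Set
UniqueMultiset {k} P = Σ (List (Vec ℕ k)) (λ L → P L × (∀ L' → P L' → L' ↭ L))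

{-# OPTIONS --safe #-}
module Submission where

-- Since V* excludes only the top vector, the size ℓ of the multiset is the upper right entry of T, and T then
-- determines the multiset of entries of each row; the column condition on T says that row a dominates row a + 1.
-- Vectors are built from the last entry to the first.  To prepend a row X of entries to a list L of suffixes, let P
-- be the lexicographically least suffix.  In any solution P must receive the least x ∈ X (nonnesting), respectively
-- the greatest x ∈ X below the head of P (noncrossing).  Conversely this choice is compatible with all others and
-- removing P and x preserves dominance, because the head of P is least among the heads.

open import Defs
open import Data.Nat using (ℕ; _≤_; _<_; zero; suc; _+_; _∸_; z≤n; s≤s; s≤s⁻¹; _<?_; _≤?_; _≥_; _⊓_)
open import Data.Nat.Properties
open import Data.Fin using (Fin; toℕ; zero; suc; fromℕ<)
open import Data.Fin.Properties using (toℕ-injective; toℕ<n; toℕ-fromℕ<)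
open import Data.Vec using (Vec; lookup; []; _∷_; head; tail)
open import Data.List using (List; length; filter; map; replicate; []; _∷_; _++_)
open import Data.List.Properties using (filter-none; filter-all; filter-some; filter-++; length-++; filter-accept; filter-reject; length-map; length-replicate; filter-notAll)
open import Data.List.Membership.Propositional using (_∈_; lose; find)
open import Data.List.Membership.Propositional.Properties using (∈-∃++; ∈-map⁺; ∈-map⁻; ∈-filter⁺; ∈-filter⁻)
open import Data.List.Relation.Unary.Any using (Any; here; there)
open import Data.List.Relation.Unary.All using (All)
import Data.List.Relation.Unary.All as All
open import Data.List.Relation.Binary.Permutation.Propositional using (_↭_; prep; ↭-refl; ↭-sym; ↭-trans; ↭-reflexive)
open import Data.List.Relation.Binary.Permutation.Propositional.Properties using (∈-resp-↭; ↭-length; shift; drop-∷; filter-↭; map⁺; ¬x∷xs↭[])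
open import Data.Product using (_×_; _,_; ∃; proj₁; proj₂)
open import Data.Sum using (_⊎_; inj₁; inj₂; reduce)
open import Data.Unit using (⊤; tt)
open import Function using (_∘_; flip)
open import Relation.Nullary using (¬_; yes; no; contradiction)
open import Relation.Binary.Definitions using (Total; Transitive; tri<; tri≈; tri>)
open import Relation.Binary.PropositionalEquality

private variable
  A : Set
  k m : ℕ

-- Extracting elements and finding least elements of lists.

∈⇒↭∷ : {x : A} {xs : List A} → x ∈ xs → ∃ λ ys → xs ↭ x ∷ ys
∈⇒↭∷ {x = x} x∈xs with ∈-∃++ x∈xs
... | ys , zs , refl = ys ++ zs , shift x ys zs

least : {_≲_ : A → A → Set} → Total _≲_ → Transitive _≲_ → ∀ x xs →
  ∃ λ m → m ∈ x ∷ xs × (∀ {y} → y ∈ x ∷ xs → m ≲ y)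
least total trans′ x [] = x , here refl , λ { (here refl) → reduce (total x x) }
least total trans′ x (y ∷ xs) with least total trans′ y xs
... | m , m∈ , m≲ with total x m
...   | inj₂ m≲x = m , there m∈ , λ { (here refl) → m≲x ; (there z∈) → m≲ z∈ }
...   | inj₁ x≲m = x , here refl , λ { (here refl) → reduce (total x x) ; (there z∈) → trans′ x≲m (m≲ z∈) }

-- Counting functions of finite multisets of natural numbers.

below : ℕ → List ℕ → ℕ
below c X = length (filter (_<? c) X)

below-↭ : ∀ {X Y} c → X ↭ Y → below c X ≡ below c Y
below-↭ c p = ↭-length (filter-↭ (_<? c) p)

below-∷-< : ∀ {x c} X → x < c → below c (x ∷ X) ≡ suc (below c X)
below-∷-< {c = c} X x<c = cong length (filter-accept (_<? c) {xs = X} x<c)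

below-∷-≮ : ∀ {x c} X → ¬ x < c → below c (x ∷ X) ≡ below c X
below-∷-≮ {c = c} X x≮c = cong length (filter-reject (_<? c) {xs = X} x≮c)

below-none : ∀ {c X} → (∀ {x} → x ∈ X → c ≤ x) → below c X ≡ 0
below-none {c} c≤ = cong length (filter-none (_<? c) (All.tabulate λ x∈ → ≤⇒≯ (c≤ x∈)))

below-all : ∀ {c X} → (∀ {x} → x ∈ X → x < c) → below c X ≡ length X
below-all {c} <c = cong length (filter-all (_<? c) (All.tabulate <c))

below-none⁻ : ∀ {c X x} → below c X ≡ 0 → x ∈ X → c ≤ x
below-none⁻ {c} {X} {x} eq x∈ with x <? c
... | no x≮c = ≮⇒≥ x≮c
... | yes x<c = contradiction (sym eq) (<⇒≢ (filter-some (_<? c) (lose x∈ x<c)))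

below-all⁻ : ∀ {c X x} → below c X ≡ length X → x ∈ X → x < c
below-all⁻ {c} {X} {x} eq x∈ with x <? c
... | yes x<c = x<c
... | no x≮c = contradiction eq (<⇒≢ (filter-notAll (_<? c) X (lose x∈ x≮c)))

below-≤-∷ : ∀ {c} x X → below c X ≤ below c (x ∷ X)
below-≤-∷ {c} x X with x <? c
... | yes x<c = subst (below c X ≤_) (sym (below-∷-< X x<c)) (n≤1+n _)
... | no x≮c = ≤-reflexive (sym (below-∷-≮ X x≮c))

below-mono : ∀ {c d} X → c ≤ d → below c X ≤ below d X
below-mono [] c≤d = z≤n
below-mono {c} {d} (x ∷ X) c≤d with x <? c
... | yes x<c = subst₂ _≤_ (sym (below-∷-< X x<c)) (sym (below-∷-< X (<-≤-trans x<c c≤d))) (s≤s (below-mono X c≤d))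
... | no x≮c = ≤-trans (≤-reflexive (below-∷-≮ X x≮c)) (≤-trans (below-mono X c≤d) (below-≤-∷ x X))

-- Entries other than `x` contribute equally to both counts, so only an entry equal to `x` can make
-- the count jump.
below⇒∈ : ∀ {x X} → below x X < below (suc x) X → x ∈ X
below⇒∈ {x} {y ∷ X} lt with <-cmp x y
... | tri≈ _ refl _ = here refl
... | tri< x<y _ _ = there (below⇒∈ (subst₂ _<_ (below-∷-≮ X (<⇒≯ x<y)) (below-∷-≮ X (≤⇒≯ x<y)) lt))
... | tri> _ _ y<x = there (below⇒∈ (s≤s⁻¹ (subst₂ _<_ (below-∷-< X y<x) (below-∷-< X (m<n⇒m<1+n y<x)) lt)))

below-cancel : ∀ {X Y} z c → below c (z ∷ X) ≡ below c (z ∷ Y) → below c X ≡ below c Y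
below-cancel {X} {Y} z c eq with z <? c
... | yes z<c = suc-injective (trans (sym (below-∷-< X z<c)) (trans eq (below-∷-< Y z<c)))
... | no z≮c = trans (sym (below-∷-≮ X z≮c)) (trans eq (below-∷-≮ Y z≮c))

-- The jump of the count at the first entry `x` of `X` forces `x` to occur in `Y`; cancel it on both
-- sides and recurse.
below-injective : ∀ X Y → (∀ c → below c X ≡ below c Y) → X ↭ Y
below-injective [] [] eq = ↭-refl
below-injective [] (y ∷ Y) eq with trans (eq (suc y)) (below-∷-< {x = y} Y ≤-refl)
... | ()
below-injective (x ∷ X) Y eq with ∈⇒↭∷ {x = x} {Y} (below⇒∈ x-counted)
  where
  x-counted : below x Y < below (suc x) Y
  x-counted = subst₂ _<_ (trans (sym (below-∷-≮ X (<-irrefl refl))) (eq x))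
    (trans (sym (below-∷-< X ≤-refl)) (eq (suc x)))
    (s≤s (below-mono X (n≤1+n x)))
... | Y₁ , Y↭ = ↭-trans (prep x (below-injective X Y₁
        λ c → below-cancel x c (trans (eq c) (below-↭ c Y↭)))) (↭-sym Y↭)

-- Dominance between consecutive rows.

-- For multisets of equal size, the j-th smallest entry of `Y` exceeds the j-th smallest of `X`: the
-- Hall condition for giving each entry of `Y` its own strictly smaller entry of `X`.
Dominates : List ℕ → List ℕ → Set
Dominates Y X = ∀ c → below (suc c) Y ≤ below c X

dominates-↭ : ∀ {X X′ Y Y′} → Y ↭ Y′ → X ↭ X′ → Dominates Y X → Dominates Y′ X′
dominates-↭ p q dom c = subst₂ _≤_ (below-↭ (suc c) p) (below-↭ c q) (dom c)

below-some⁻ : ∀ {c} X → 0 < below c X → Any (_< c) X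
below-some⁻ {c} (x ∷ X) lt with x <? c
... | yes x<c = here x<c
... | no x≮c = there (below-some⁻ X (subst (0 <_) (below-∷-≮ X x≮c) lt))

-- At `c = h` the count in `Y` includes `h` itself, so the count in `X` is positive.
dominates-some : ∀ {h X Y} → Dominates Y X → h ∈ Y → Any (_< h) X
dominates-some {h} {X} dom h∈ =
  below-some⁻ X (≤-trans (filter-some (_<? suc h) (lose h∈ ≤-refl)) (dom h))

-- For `c` at least `h` both removed entries were counted, so each side drops by one; for smaller
-- `c` nothing in `Y` is counted.
dominates-remove : ∀ {h x X Y} → x < h → (∀ {y} → y ∈ Y → h ≤ y) →
  Dominates (h ∷ Y) (x ∷ X) → Dominates Y X
dominates-remove {h} {x} {X} {Y} x<h h≤ dom c with h ≤? c
... | yes h≤c = s≤s⁻¹ (subst₂ _≤_ (below-∷-< Y (s≤s h≤c)) (below-∷-< X (<-≤-trans x<h h≤c)) (dom c))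
... | no h≰c = subst (_≤ below c X) (sym (below-none λ y∈ → ≤-trans (≰⇒> h≰c) (h≤ y∈))) z≤n

-- Strictly increasing vectors below a bound.

-- The value N stands for an entry following the last one.
hd : ℕ → Vec ℕ k → ℕ
hd N [] = N
hd N (x ∷ _) = x

Increasing : ℕ → Vec ℕ k → Set
Increasing N [] = ⊤
Increasing N (x ∷ P) = x < hd N P × Increasing N P

hd+index≤lookup : ∀ {N} {P : Vec ℕ k} → Increasing N P → ∀ a → hd N P + toℕ a ≤ lookup P a
hd+index≤lookup {P = x ∷ P} inc zero = ≤-reflexive (+-identityʳ x)
hd+index≤lookup {P = x ∷ P} (x< , inc) (suc a) =
  subst (_≤ lookup P a) (sym (+-suc x (toℕ a))) (≤-trans (+-monoˡ-≤ (toℕ a) x<) (hd+index≤lookup inc a))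

hd≤lookup : ∀ {N} {P : Vec ℕ k} → Increasing N P → ∀ a → hd N P ≤ lookup P a
hd≤lookup {N = N} {P} inc a = m+n≤o⇒m≤o (hd N P) (hd+index≤lookup inc a)

hd+length≤bound : ∀ {N} {P : Vec ℕ k} → Increasing N P → hd N P + k ≤ N
hd+length≤bound {N = N} {[]} inc = ≤-reflexive (+-identityʳ N)
hd+length≤bound {suc k} {N} {x ∷ P} (x< , inc) =
  subst (_≤ N) (sym (+-suc x k)) (≤-trans (+-monoˡ-≤ k x<) (hd+length≤bound inc))

-- The entry at index `a` and its `k - 1 - a` successors must fit below `N`; the additive form
-- avoids truncated subtraction.
lookup+length≤bound+index : ∀ {N} {P : Vec ℕ k} → Increasing N P → ∀ a → lookup P a + k ≤ N + toℕ a
lookup+length≤bound+index {N = N} {x ∷ P} inc zero =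
  subst (_ ≤_) (sym (+-identityʳ N)) (hd+length≤bound inc)
lookup+length≤bound+index {suc k} {N} {x ∷ P} (_ , inc) (suc a) =
  subst₂ _≤_ (sym (+-suc (lookup P a) k)) (sym (+-suc N (toℕ a))) (s≤s (lookup+length≤bound+index inc a))

lookup-mono-< : ∀ {N} {P : Vec ℕ k} → Increasing N P → ∀ a b → toℕ a < toℕ b → lookup P a < lookup P b
lookup-mono-< {P = x ∷ P} (x< , inc) zero (suc b) _ = <-≤-trans x< (hd≤lookup inc b)
lookup-mono-< {P = x ∷ P} (x< , inc) (suc a) (suc b) (s≤s a<b) = lookup-mono-< inc a b a<b

hd<bound : ∀ {N} {x} {P : Vec ℕ k} → Increasing N (x ∷ P) → x < N
hd<bound {P = []} (x< , _) = x<
hd<bound {P = y ∷ P} (x< , inc) = <-trans x< (hd<bound inc)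

lookup<bound : ∀ {N} {P : Vec ℕ k} → Increasing N P → ∀ a → lookup P a < N
lookup<bound {P = x ∷ P} inc zero = hd<bound inc
lookup<bound {P = x ∷ P} (_ , inc) (suc a) = lookup<bound inc a

increasing : ∀ {N} (P : Vec ℕ k) → (∀ a → lookup P a < N) →
  (∀ a b → toℕ a < toℕ b → lookup P a < lookup P b) → Increasing N P
increasing [] <N mono = tt
increasing (x ∷ []) <N mono = <N zero , tt
increasing (x ∷ P@(y ∷ _)) <N mono =
  mono zero (suc zero) (s≤s z≤n) , increasing P (<N ∘ suc) (λ a b a<b → mono (suc a) (suc b) (s≤s a<b))

-- Lexicographic order on vectors.

data _≼_ : Vec ℕ k → Vec ℕ k → Set where
  []   : [] ≼ []
  this : ∀ {x y} {P Q : Vec ℕ k} → x < y → (x ∷ P) ≼ (y ∷ Q)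
  next : ∀ {x} {P Q : Vec ℕ k} → P ≼ Q → (x ∷ P) ≼ (x ∷ Q)

≼-total : Total (_≼_ {k})
≼-total [] [] = inj₁ []
≼-total (x ∷ P) (y ∷ Q) with <-cmp x y
... | tri< x<y _ _ = inj₁ (this x<y)
... | tri> _ _ y<x = inj₂ (this y<x)
... | tri≈ _ refl _ with ≼-total P Q
...   | inj₁ P≼Q = inj₁ (next P≼Q)
...   | inj₂ Q≼P = inj₂ (next Q≼P)

≼-trans : Transitive (_≼_ {k})
≼-trans [] [] = []
≼-trans (this p) (this q) = this (<-trans p q)
≼-trans (this p) (next q) = this p
≼-trans (next p) (this q) = this q
≼-trans (next p) (next q) = next (≼-trans p q)

≼⇒hd≤ : ∀ {N} {P Q : Vec ℕ k} → P ≼ Q → hd N P ≤ hd N Q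
≼⇒hd≤ [] = ≤-refl
≼⇒hd≤ (this x<y) = <⇒≤ x<y
≼⇒hd≤ (next _) = ≤-refl

AgreeBefore : Vec ℕ k → Vec ℕ k → Fin k → Set
AgreeBefore P Q a = ∀ l → toℕ l < toℕ a → lookup P l ≡ lookup Q l

-- Exhibits the first index of difference; the two entries there serve as right ends of a forbidden
-- pair of arcs.
_≺_ : Vec ℕ k → Vec ℕ k → Set
P ≺ Q = ∃ λ a → AgreeBefore P Q a × lookup P a < lookup Q a

≼⇒≡⊎≺ : {P Q : Vec ℕ k} → P ≼ Q → P ≡ Q ⊎ P ≺ Q
≼⇒≡⊎≺ [] = inj₁ refl
≼⇒≡⊎≺ (this x<y) = inj₂ (zero , (λ _ ()) , x<y)
≼⇒≡⊎≺ (next P≼Q) with ≼⇒≡⊎≺ P≼Q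
... | inj₁ refl = inj₁ refl
... | inj₂ (a , agree , lt) = inj₂ (suc a , (λ { zero _ → refl ; (suc l) (s≤s l<a) → agree l l<a }) , lt)

≼-agree : {P Q : Vec ℕ k} → P ≼ Q → ∀ a → AgreeBefore P Q a → lookup P a ≤ lookup Q a
≼-agree (this x<y) zero agree = <⇒≤ x<y
≼-agree (this x<y) (suc a) agree = contradiction (agree zero (s≤s z≤n)) (<⇒≢ x<y)
≼-agree (next P≼Q) zero agree = ≤-refl
≼-agree (next P≼Q) (suc a) agree = ≼-agree P≼Q a (λ l l<a → agree (suc l) (s≤s l<a))

-- The greedy rule shared by the two relations.

-- Prefers h x y: a suffix with head h takes x rather than y.
record Rule (N : ℕ) : Set₁ where
  field
    R : ∀ k → Vec ℕ k → Vec ℕ k → Set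
    R-refl : (P : Vec ℕ k) → R k P P
    R-sym : {P Q : Vec ℕ k} → R k P Q → R k Q P
    R-tail : ∀ {x y} {P Q : Vec ℕ k} → R (suc k) (x ∷ P) (y ∷ Q) → R k P Q
    Prefers : ℕ → ℕ → ℕ → Set
    select : ∀ h X → Any (_< h) X → ∃ λ x → x ∈ X × x < h × (∀ {y} → y ∈ X → Prefers h x y)
    -- Source of uniqueness: the least suffix `P` cannot carry `y` while a later suffix `Q` carries
    -- a preferred `x` other than `y`.
    forced : ∀ {x y} {P Q : Vec ℕ k} → Increasing N P → Prefers (hd N P) x y → x < hd N P → y < hd N P → P ≺ Q →
      R (suc k) (y ∷ P) (x ∷ Q) → x ≡ y
    -- Source of existence: the preferred entry on the least suffix stays compatible with whatever
    -- the other suffixes receive.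
    extend : ∀ {x y} {P Q : Vec ℕ k} → Prefers (hd N P) x y → x < hd N P → y < hd N Q → P ≼ Q →
      Increasing N Q → R k P Q → R (suc k) (x ∷ P) (y ∷ Q)

-- Attaching one row of entries to a list of suffixes.

module _ {N : ℕ} (rule : Rule N) where
  open Rule rule

  Compatible : List (Vec ℕ k) → Set
  Compatible L = (∀ {v} → v ∈ L → Increasing N v) × Pairwise (R _) L

  compatible-↭ : {L L′ : List (Vec ℕ k)} → L ↭ L′ → Compatible L → Compatible L′
  compatible-↭ p (inc , pw) = (λ v∈ → inc (back v∈)) , (λ I J I∈ J∈ → pw I J (back I∈) (back J∈))
    where
    back : ∀ {v} → v ∈ _ → v ∈ _
    back = ∈-resp-↭ (↭-sym p)

  compatible-tail : {L : List (Vec ℕ k)} {v : Vec ℕ k} → Compatible (v ∷ L) → Compatible L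
  compatible-tail (inc , pw) = (inc ∘ there) , (λ I J I∈ J∈ → pw I J (there I∈) (there J∈))

  -- `Pairwise` also compares a vector with itself and in both orders, hence the use of `R-refl` and
  -- `R-sym`.
  compatible-∷ : {L : List (Vec ℕ k)} {v : Vec ℕ k} → Increasing N v → (∀ {w} → w ∈ L → R _ v w) →
    Compatible L → Compatible (v ∷ L)
  compatible-∷ {v = v} inc-v rel (inc , pw) =
    (λ { (here refl) → inc-v ; (there w∈) → inc w∈ }) ,
    λ { _ _ (here refl) (here refl) → R-refl v
      ; _ _ (here refl) (there J∈) → rel J∈
      ; _ _ (there I∈) (here refl) → R-sym (rel I∈)
      ; I J (there I∈) (there J∈) → pw I J I∈ J∈ }

  record Matching (L : List (Vec ℕ k)) (X : List ℕ) (M : List (Vec ℕ (suc k))) : Set where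
    constructor matching
    field
      tails : map tail M ↭ L
      heads : map head M ↭ X
      compatible : Compatible M

  open Matching

  matching-tail : ∀ {L X M} {x} {P : Vec ℕ k} → Matching (P ∷ L) (x ∷ X) ((x ∷ P) ∷ M) → Matching L X M
  matching-tail (matching t h c) = matching (drop-∷ t) (drop-∷ h) (compatible-tail c)

  matching-↭ : ∀ {L L′ : List (Vec ℕ k)} {X X′ M M′} → L ↭ L′ → X ↭ X′ → M ↭ M′ →
    Matching L X M → Matching L′ X′ M′
  matching-↭ p q r (matching t h c) =
    matching (↭-trans (↭-sym (map⁺ tail r)) (↭-trans t p)) (↭-trans (↭-sym (map⁺ head r)) (↭-trans h q))
      (compatible-↭ r c)

  -- Some vector of `M` has head `x` and some vector has tail `P`. If they differ in tail, then `P`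
  -- strictly precedes the other tail, and `forced` shows that the vector ending in `P` also begins
  -- with `x`.
  matching-forced : ∀ {L : List (Vec ℕ k)} {X M x P} → Matching L X M →
    P ∈ L → (∀ {Q} → Q ∈ L → P ≼ Q) → x ∈ X → x < hd N P →
    (∀ {y} → y ∈ X → Prefers (hd N P) x y) →
    (x ∷ P) ∈ M
  matching-forced mt P∈ P≼ x∈ x<h x-preferred
    with ∈-map⁻ head (∈-resp-↭ (↭-sym (heads mt)) x∈) | ∈-map⁻ tail (∈-resp-↭ (↭-sym (tails mt)) P∈)
  ... | (x ∷ Q) , v∈ , refl | (y ∷ P) , w∈ , refl
    with ≼⇒≡⊎≺ (P≼ (∈-resp-↭ (tails mt) (∈-map⁺ tail v∈)))
  ...   | inj₁ refl = v∈
  ...   | inj₂ P≺Q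
    with y<P , inc ← proj₁ (compatible mt) w∈
    with refl ← forced inc (x-preferred (∈-resp-↭ (heads mt) (∈-map⁺ head w∈))) x<h y<P P≺Q
                  (proj₂ (compatible mt) _ _ w∈ v∈) = w∈

  -- Induction on the common size: split off the least suffix and its preferred entry. `extend` puts
  -- the new vector back for existence; for uniqueness every solution contains it, and deleting it
  -- leaves a solution of the smaller problem.
  matching-unique-exists : ∀ ℓ (L : List (Vec ℕ k)) X → length L ≡ ℓ → length X ≡ ℓ →
    Compatible L → Dominates (map (hd N) L) X →
    ∃ λ M → Matching L X M × (∀ M′ → Matching L X M′ → M′ ↭ M)
  matching-unique-exists zero [] [] refl refl comp dom =
    [] , matching ↭-refl ↭-refl ((λ ()) , (λ _ _ ())) ,
    λ { [] _ → ↭-refl ; (_ ∷ _) mt → contradiction (heads mt) ¬x∷xs↭[] }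
  matching-unique-exists (suc ℓ) (V ∷ L) X eqL eqX comp dom
    with P , P∈ , P≼ ← least ≼-total ≼-trans V L
    -- Dominance supplies an entry below the head of `P`, so the selection is possible.
    with x , x∈ , x<h , x-preferred ← select (hd N P) X (dominates-some {X = X} dom (∈-map⁺ (hd N) P∈))
    with L₁ , L↭ ← ∈⇒↭∷ P∈
    with X₁ , X↭ ← ∈⇒↭∷ x∈
    with compPL ← compatible-↭ L↭ comp
    with M₁ , mt₁ , unique ← matching-unique-exists ℓ L₁ X₁
           (suc-injective (trans (sym (↭-length L↭)) eqL)) (suc-injective (trans (sym (↭-length X↭)) eqX))
           (compatible-tail compPL)
           (dominates-remove x<h
             (λ y∈ → let Q , Q∈ , y≡ = ∈-map⁻ (hd N) y∈ in
               subst (hd N P ≤_) (sym y≡) (≼⇒hd≤ (P≼ (∈-resp-↭ (↭-sym L↭) (there Q∈)))))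
             (dominates-↭ {X = X} {Y = map (hd N) (V ∷ L)} (map⁺ (hd N) L↭) X↭ dom))
    = (x ∷ P) ∷ M₁
    , matching-↭ (↭-sym L↭) (↭-sym X↭) ↭-refl
        (matching (prep P (tails mt₁)) (prep x (heads mt₁))
          (compatible-∷ (x<h , proj₁ compPL (here refl)) related (compatible mt₁)))
    , λ M′ mt′ →
        let M′₁ , M′↭ = ∈⇒↭∷ (matching-forced mt′ P∈ P≼ x∈ x<h x-preferred) in
        ↭-trans M′↭ (prep (x ∷ P) (unique M′₁ (matching-tail (matching-↭ L↭ X↭ M′↭ mt′))))
    where
    related : ∀ {w} → w ∈ M₁ → R _ (x ∷ P) w
    related {y ∷ Q} w∈ =
      let Q∈ = there (∈-resp-↭ (tails mt₁) (∈-map⁺ tail w∈))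
          y∈ = there (∈-resp-↭ (heads mt₁) (∈-map⁺ head w∈))
          y<Q , inc = proj₁ (compatible mt₁) w∈ in
      extend (x-preferred (∈-resp-↭ (↭-sym X↭) y∈)) x<h y<Q (P≼ (∈-resp-↭ (↭-sym L↭) Q∈)) inc
        (proj₂ compPL _ _ (here refl) Q∈)

  -- Building the vectors row by row, from the last row to the first.

  -- The length is recorded separately because for `k = 0` there are no rows to determine it.
  Realizes : (Fin k → List ℕ) → ℕ → List (Vec ℕ k) → Set
  Realizes rows ℓ L = length L ≡ ℓ × (∀ a → map (λ v → lookup v a) L ↭ rows a) × Compatible L

  -- A virtual row of `ℓ` copies of `N` follows the last row, so that the upper bound on the last
  -- row is one more dominance condition.
  nextRow : ∀ k → ℕ → (Fin (suc k) → List ℕ) → List ℕ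
  nextRow zero ℓ rows = replicate ℓ N
  nextRow (suc k) ℓ rows = rows (suc zero)

  Admissible : ∀ k → ℕ → (Fin k → List ℕ) → Set
  Admissible zero ℓ rows = ⊤
  Admissible (suc k) ℓ rows =
    length (rows zero) ≡ ℓ × Dominates (nextRow k ℓ rows) (rows zero) × Admissible k ℓ (rows ∘ suc)

  map-hd↭nextRow : ∀ {k ℓ} {rows : Fin (suc k) → List ℕ} {L} →
    Realizes (rows ∘ suc) ℓ L → map (hd N) L ↭ nextRow k ℓ rows
  map-hd↭nextRow {zero} {L = L} (refl , _) = ↭-reflexive (const-hd L)
    where
    const-hd : (L : List (Vec ℕ 0)) → map (hd N) L ≡ replicate (length L) N
    const-hd [] = refl
    const-hd ([] ∷ L) = cong (N ∷_) (const-hd L)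
  map-hd↭nextRow {suc k} {L = L} (_ , r , _) = subst (_↭ _) (map-lookup-zero L) (r zero)
    where
    map-lookup-zero : (L : List (Vec ℕ (suc k))) → map (λ v → lookup v zero) L ≡ map (hd N) L
    map-lookup-zero [] = refl
    map-lookup-zero ((x ∷ v) ∷ L) = cong (x ∷_) (map-lookup-zero L)

  map-head : (L : List (Vec ℕ (suc k))) → map head L ≡ map (λ v → lookup v zero) L
  map-head [] = refl
  map-head ((x ∷ v) ∷ L) = cong (x ∷_) (map-head L)

  map-lookup-tail : ∀ (L : List (Vec ℕ (suc k))) a →
    map (λ v → lookup v a) (map tail L) ≡ map (λ v → lookup v (suc a)) L
  map-lookup-tail [] a = refl
  map-lookup-tail ((x ∷ v) ∷ L) a = cong (lookup v a ∷_) (map-lookup-tail L a)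

  realizes-tail : ∀ {ℓ} {rows : Fin (suc k) → List ℕ} {M} →
    Realizes rows ℓ M → Realizes (rows ∘ suc) ℓ (map tail M)
  realizes-tail {rows = rows} {M} (len , r , inc , pw) =
    trans (length-map tail M) len ,
    (λ a → subst (_↭ rows (suc a)) (sym (map-lookup-tail M a)) (r (suc a))) ,
    (λ v∈ → let w , w∈ , v≡ = ∈-map⁻ tail v∈ in subst (Increasing N) (sym v≡) (inc-tail (inc w∈))) ,
    λ I J I∈ J∈ →
      let I′ , I′∈ , I≡ = ∈-map⁻ tail I∈
          J′ , J′∈ , J≡ = ∈-map⁻ tail J∈ in
      subst₂ (R _) (sym I≡) (sym J≡) (rel-tail I′ J′ (pw I′ J′ I′∈ J′∈))
    where
    inc-tail : {w : Vec ℕ (suc k)} → Increasing N w → Increasing N (tail w)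
    inc-tail {w = _ ∷ _} = proj₂
    rel-tail : (v w : Vec ℕ (suc k)) → R _ v w → R _ (tail v) (tail w)
    rel-tail (_ ∷ _) (_ ∷ _) = R-tail

  -- The tails of any solution solve the problem for the later rows, so they are known up to
  -- permutation by induction; attaching the first row to them is the matching problem.
  realizes-unique-exists : ∀ k ℓ (rows : Fin k → List ℕ) → Admissible k ℓ rows →
    ∃ λ L → Realizes rows ℓ L × (∀ L′ → Realizes rows ℓ L′ → L′ ↭ L)
  realizes-unique-exists zero ℓ rows adm =
    replicate ℓ [] ,
    (length-replicate ℓ , (λ ()) , (λ { {[]} _ → tt }) , (λ { [] [] _ _ → R-refl [] })) ,
    λ L′ (len , _) → ↭-reflexive (trans (nulls L′) (cong (λ ℓ → replicate ℓ []) len))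
    where
    nulls : (L : List (Vec ℕ 0)) → L ≡ replicate (length L) []
    nulls [] = refl
    nulls ([] ∷ L) = cong ([] ∷_) (nulls L)
  realizes-unique-exists (suc k) ℓ rows (len , dom , adm)
    with L , realizes , L-unique ← realizes-unique-exists k ℓ (rows ∘ suc) adm
    with M , mt , M-unique ← matching-unique-exists ℓ L (rows zero) (proj₁ realizes) len
           (proj₂ (proj₂ realizes)) (dominates-↭ {X = rows zero} (↭-sym (map-hd↭nextRow {rows = rows} realizes)) ↭-refl dom)
    = M
    , ( trans (sym (length-map head M)) (trans (↭-length (heads mt)) len)
      , (λ { zero → subst (_↭ rows zero) (map-head M) (heads mt)
           ; (suc a) → subst (_↭ rows (suc a)) (map-lookup-tail M a)
               (↭-trans (map⁺ (λ v → lookup v a) (tails mt)) (proj₁ (proj₂ realizes) a)) })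
      , compatible mt)
    , λ M′ r′ → M-unique M′ (matching (L-unique (map tail M′) (realizes-tail {rows = rows} r′))
        (subst (_↭ rows zero) (sym (map-head M′)) (proj₁ (proj₂ r′) zero))
        (proj₂ (proj₂ r′)))

-- The nonnesting rule: prefer the least entry.

nonnestingRule : ∀ N → Rule N
nonnestingRule N = record
  { R = Nonnesting
  ; R-refl = λ _ _ _ _ → λ { (inj₁ (p<p , _)) → <-irrefl refl p<p ; (inj₂ (p<p , _)) → <-irrefl refl p<p }
  ; R-sym = λ rel a b a<b → λ { (inj₁ nest) → rel a b a<b (inj₂ nest) ; (inj₂ nest) → rel a b a<b (inj₁ nest) }
  ; R-tail = λ rel a b a<b → rel (suc a) (suc b) (s≤s a<b)
  ; Prefers = λ _ x y → x ≤ y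
  ; select = select
  ; forced = forced
  ; extend = extend
  }
  where
  select : ∀ h X → Any (_< h) X → ∃ λ x → x ∈ X × x < h × (∀ {y} → y ∈ X → x ≤ y)
  select h X@(z ∷ Z) some with least ≤-total ≤-trans z Z | find some
  ... | x , x∈ , x≤ | y , y∈ , y<h = x , x∈ , ≤-<-trans (x≤ y∈) y<h , x≤

  -- Were `x < y`, the arc from `y` to the first differing entry of `P` would lie inside the arc
  -- from `x` to that of `Q`.
  forced : ∀ {x y} {P Q : Vec ℕ k} → Increasing N P → x ≤ y → x < hd N P → y < hd N P → P ≺ Q →
    Nonnesting (suc k) (y ∷ P) (x ∷ Q) → x ≡ y
  forced inc x≤y _ y<P (a , _ , p<q) rel with m≤n⇒m<n∨m≡n x≤y
  ... | inj₂ x≡y = x≡y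
  ... | inj₁ x<y = contradiction (inj₂ (x<y , <-≤-trans y<P (hd≤lookup inc a) , p<q))
                     (rel zero (suc a) (s≤s z≤n))

  -- A nesting with the new heads needs `Q` smaller than `P` at index `b`. The first difference then
  -- comes earlier, with `P` smaller there, and together with `b` gives a nesting of `P` and `Q`
  -- themselves.
  extend : ∀ {x y} {P Q : Vec ℕ k} → x ≤ y → x < hd N P → y < hd N Q → P ≼ Q →
    Increasing N Q → Nonnesting k P Q → Nonnesting (suc k) (x ∷ P) (y ∷ Q)
  extend x≤y _ _ P≼Q inc rel zero (suc b) _ (inj₂ (y<x , _)) = ≤⇒≯ x≤y y<x
  extend x≤y _ _ P≼Q inc rel zero (suc b) _ (inj₁ (_ , _ , q<p)) with ≼⇒≡⊎≺ P≼Q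
  ... | inj₁ refl = <-irrefl refl q<p
  ... | inj₂ (a , agree , p<q) with <-cmp (toℕ a) (toℕ b)
  ...   | tri< a<b _ _ = rel a b a<b (inj₁ (p<q , lookup-mono-< inc a b a<b , q<p))
  ...   | tri≈ _ a≡b _ with refl ← toℕ-injective a≡b = <-asym p<q q<p
  ...   | tri> _ _ b<a = <-irrefl (sym (agree b b<a)) q<p
  extend x≤y _ _ P≼Q inc rel (suc a) (suc b) (s≤s a<b) = rel a b a<b

-- The noncrossing rule: prefer the greatest entry below the head.

noncrossingRule : ∀ N → Rule N
noncrossingRule N = record
  { R = Noncrossing
  ; R-refl = λ _ _ _ _ _ → λ { (inj₁ (p<p , _)) → <-irrefl refl p<p ; (inj₂ (p<p , _)) → <-irrefl refl p<p }
  ; R-sym = λ rel a b a<b agree →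
      λ { (inj₁ cross) → rel a b a<b (λ l a<l l<b → sym (agree l a<l l<b)) (inj₂ cross)
        ; (inj₂ cross) → rel a b a<b (λ l a<l l<b → sym (agree l a<l l<b)) (inj₁ cross) }
  ; R-tail = λ rel a b a<b agree →
      rel (suc a) (suc b) (s≤s a<b) (λ { (suc l) (s≤s a<l) (s≤s l<b) → agree l a<l l<b })
  ; Prefers = λ h x y → y < h → y ≤ x
  ; select = select
  ; forced = forced
  ; extend = extend
  }
  where
  select : ∀ h X → Any (_< h) X → ∃ λ x → x ∈ X × x < h × (∀ {y} → y ∈ X → y < h → y ≤ x)
  select h X some with find some
  ... | y , y∈ , y<h with filter (_<? h) X in eq | ∈-filter⁺ (_<? h) y∈ y<h
  -- With the order reversed, `least` returns the greatest candidate.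
  ...   | z ∷ Z | _ with least {_≲_ = _≥_} (flip ≤-total) (flip ≤-trans) z Z
  ...     | x , x∈ , ≤x with ∈-filter⁻ (_<? h) {xs = X} (subst (x ∈_) (sym eq) x∈)
  ...       | x∈X , x<h = x , x∈X , x<h , λ y∈ y<h → ≤x (subst (_ ∈_) eq (∈-filter⁺ (_<? h) y∈ y<h))

  -- Were `y < x`, the arcs to the first differing entries would cross, and the tails agree in
  -- between as the definition of crossing vectors demands.
  forced : ∀ {x y} {P Q : Vec ℕ k} → Increasing N P → (y < hd N P → y ≤ x) → x < hd N P → y < hd N P →
    P ≺ Q → Noncrossing (suc k) (y ∷ P) (x ∷ Q) → x ≡ y
  forced inc preferred x<P y<P (a , agree , p<q) rel with m≤n⇒m<n∨m≡n (preferred y<P)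
  ... | inj₂ y≡x = sym y≡x
  ... | inj₁ y<x = contradiction (inj₁ (y<x , <-≤-trans x<P (hd≤lookup inc a) , p<q))
                     (rel zero (suc a) (s≤s z≤n) (λ { (suc l) _ (s≤s l<a) → agree l l<a }))

  -- If `x < y` in a crossing, then `y` lies below the head of `P`: directly when the right ends are
  -- the heads, otherwise because the heads agree. This contradicts the preference. The opposite
  -- crossing contradicts the lexicographic order.
  extend : ∀ {x y} {P Q : Vec ℕ k} → (y < hd N P → y ≤ x) → x < hd N P → y < hd N Q → P ≼ Q →
    Increasing N Q → Noncrossing k P Q → Noncrossing (suc k) (x ∷ P) (y ∷ Q)
  extend {P = _ ∷ _} {_ ∷ _} preferred _ _ _ _ _ zero (suc zero) _ _ (inj₁ (x<y , y<p , _)) =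
    ≤⇒≯ (preferred y<p) x<y
  extend {P = p ∷ _} {q ∷ _} preferred _ y<Q _ _ _ zero (suc (suc b)) _ agree (inj₁ (x<y , _)) =
    ≤⇒≯ (preferred (subst (_ <_) (sym (agree (suc zero) (s≤s z≤n) (s≤s (s≤s z≤n)))) y<Q)) x<y
  extend _ _ _ P≼Q _ _ zero (suc b) _ agree (inj₂ (_ , _ , q<p)) =
    ≤⇒≯ (≼-agree P≼Q b (λ l l<b → agree (suc l) (s≤s z≤n) (s≤s l<b))) q<p
  extend _ _ _ _ _ rel (suc a) (suc b) (s≤s a<b) agree =
    rel a b a<b (λ l a<l l<b → agree (suc l) (s≤s a<l) (s≤s l<b))

-- Multisets with a prescribed counting function.

below-replicate-≥ : ∀ {x c} r → c ≤ x → below c (replicate r x) ≡ 0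
below-replicate-≥ zero c≤x = refl
below-replicate-≥ {x} (suc r) c≤x = trans (below-∷-≮ (replicate r x) (≤⇒≯ c≤x)) (below-replicate-≥ r c≤x)

below-replicate-< : ∀ {x c} r → x < c → below c (replicate r x) ≡ r
below-replicate-< zero x<c = refl
below-replicate-< {x} (suc r) x<c = trans (below-∷-< (replicate r x) x<c) (cong suc (below-replicate-< r x<c))

below-++ : ∀ c X Y → below c (X ++ Y) ≡ below c X + below c Y
below-++ c X Y = trans (cong length (filter-++ (_<? c) X Y)) (length-++ (filter (_<? c) X))

module _ (g : ℕ → ℕ) (g-zero : g 0 ≡ 0) (g-step : ∀ c → g c ≤ g (suc c)) where

  -- Each value occurs as often as `g` jumps there; the argument cuts the multiset off to values
  -- below it.
  withCounts : ℕ → List ℕ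
  withCounts zero = []
  withCounts (suc N) = withCounts N ++ replicate (g (suc N) ∸ g N) N

  length-withCounts : ∀ N → length (withCounts N) ≡ g N
  length-withCounts zero = sym g-zero
  length-withCounts (suc N) = begin
    length (withCounts (suc N))                                     ≡⟨ length-++ (withCounts N) ⟩
    length (withCounts N) + length (replicate (g (suc N) ∸ g N) N)  ≡⟨ cong₂ _+_ (length-withCounts N) (length-replicate _) ⟩
    g N + (g (suc N) ∸ g N)                                         ≡⟨ m+[n∸m]≡n (g-step N) ⟩
    g (suc N)                                                       ∎
    where open ≡-Reasoning

  below-withCounts : ∀ N c → below c (withCounts N) ≡ g (c ⊓ N)
  below-withCounts zero c = sym (trans (cong g (⊓-zeroʳ c)) g-zero)
  below-withCounts (suc N) c =
    trans (below-++ c (withCounts N) _) (trans (cong (_+ _) (below-withCounts N c)) last-block)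
    where
    last-block : g (c ⊓ N) + below c (replicate (g (suc N) ∸ g N) N) ≡ g (c ⊓ suc N)
    last-block with c ≤? N
    ... | yes c≤N rewrite below-replicate-≥ (g (suc N) ∸ g N) c≤N | m≤n⇒m⊓n≡m c≤N | m≤n⇒m⊓n≡m (m≤n⇒m≤1+n c≤N) =
      +-identityʳ (g c)
    ... | no c≰N rewrite below-replicate-< (g (suc N) ∸ g N) (≰⇒> c≰N) | m≥n⇒m⊓n≡n (≰⇒≥ c≰N) | m≥n⇒m⊓n≡n (≰⇒> c≰N) =
      m+[n∸m]≡n (g-step N)

-- From tableau rows to counting functions on all of ℕ.

-- The default `ℓ` is the size of the multiset: past the last column every vector is counted.
extendBy : ℕ → (Fin m → ℕ) → ℕ → ℕ
extendBy {zero} ℓ f b = ℓ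
extendBy {suc m} ℓ f zero = f zero
extendBy {suc m} ℓ f (suc b) = extendBy ℓ (f ∘ suc) b

extendBy-toℕ : ∀ {ℓ} (f : Fin m → ℕ) b → extendBy ℓ f (toℕ b) ≡ f b
extendBy-toℕ f zero = refl
extendBy-toℕ f (suc b) = extendBy-toℕ (f ∘ suc) b

extendBy-≥ : ∀ {ℓ} (f : Fin m → ℕ) {b} → m ≤ b → extendBy ℓ f b ≡ ℓ
extendBy-≥ {zero} f m≤b = refl
extendBy-≥ {suc m} f (s≤s m≤b) = extendBy-≥ (f ∘ suc) m≤b

extendBy-step : ∀ {ℓ} (f : Fin m → ℕ) → (∀ b b′ → toℕ b′ ≡ suc (toℕ b) → f b ≤ f b′) →
  (∀ b → f b ≤ ℓ) → ∀ c → extendBy ℓ f c ≤ extendBy ℓ f (suc c)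
extendBy-step {zero} f step f≤ℓ c = ≤-refl
extendBy-step {suc zero} f step f≤ℓ zero = f≤ℓ zero
extendBy-step {suc (suc m)} f step f≤ℓ zero = step zero (suc zero) refl
extendBy-step {suc m} f step f≤ℓ (suc c) =
  extendBy-step (f ∘ suc) (λ b b′ eq → step (suc b) (suc b′) (cong suc eq)) (f≤ℓ ∘ suc) c

extendBy-mono : ∀ {ℓ} {f g : Fin m → ℕ} → (∀ b → f b ≤ g b) → ∀ c → extendBy ℓ f c ≤ extendBy ℓ g c
extendBy-mono {zero} f≤g c = ≤-refl
extendBy-mono {suc m} f≤g zero = f≤g zero
extendBy-mono {suc m} f≤g (suc c) = extendBy-mono (f≤g ∘ suc) c

-- The zeros filled in on the left reflect that the a-th entry of an increasing vector of positive
-- numbers is at least a.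
delay : ℕ → (ℕ → ℕ) → ℕ → ℕ
delay zero F c = F c
delay (suc a) F zero = 0
delay (suc a) F (suc c) = delay a F c

delay-+ : ∀ a F b → delay a F (a + b) ≡ F b
delay-+ zero F b = refl
delay-+ (suc a) F b = delay-+ a F b

delay-< : ∀ {a c} F → c < a → delay a F c ≡ 0
delay-< {suc a} {zero} F c<a = refl
delay-< {suc a} {suc c} F (s≤s c<a) = delay-< F c<a

delay-step : ∀ a {F} → (∀ c → F c ≤ F (suc c)) → ∀ c → delay a F c ≤ delay a F (suc c)
delay-step zero step c = step c
delay-step (suc a) step zero = z≤n
delay-step (suc a) step (suc c) = delay-step a step c

delay-mono : ∀ a {F G} → (∀ c → F c ≤ G c) → ∀ c → delay a F c ≤ delay a G c
delay-mono zero F≤G c = F≤G c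
delay-mono (suc a) F≤G zero = z≤n
delay-mono (suc a) F≤G (suc c) = delay-mono a F≤G c

-- Generic in the relation, so as to serve rows with `_≤_` and columns with `_≥_`.
steps⇒related : {_~_ : ℕ → ℕ → Set} → (∀ {x} → x ~ x) → Transitive _~_ → (f : Fin m → ℕ) →
  (∀ b b′ → toℕ b′ ≡ suc (toℕ b) → f b ~ f b′) → ∀ b b′ → toℕ b ≤ toℕ b′ → f b ~ f b′
steps⇒related refl′ trans′ f step zero zero _ = refl′
steps⇒related {m = suc (suc m)} {_~_} refl′ trans′ f step zero (suc b′) _ =
  trans′ (step zero (suc zero) refl)
    (steps⇒related {_~_ = _~_} refl′ trans′ (f ∘ suc) (λ b b′ eq → step (suc b) (suc b′) (cong suc eq)) zero b′ z≤n)
steps⇒related {_~_ = _~_} refl′ trans′ f step (suc b) (suc b′) (s≤s b≤b′) =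
  steps⇒related {_~_ = _~_} refl′ trans′ (f ∘ suc) (λ b b′ eq → step (suc b) (suc b′) (cong suc eq)) b b′ b≤b′

count-≤≡below-map : (f : A → ℕ) (c : ℕ) (L : List A) →
  length (filter (λ v → f v ≤? c) L) ≡ below (suc c) (map f L)
count-≤≡below-map f c [] = refl
count-≤≡below-map f c (v ∷ L) with f v ≤? c
... | yes fv≤c = trans (cong length (filter-accept (λ v → f v ≤? c) {xs = L} fv≤c))
                   (trans (cong suc (count-≤≡below-map f c L)) (sym (below-∷-< (map f L) (s≤s fv≤c))))
... | no fv≰c = trans (cong length (filter-reject (λ v → f v ≤? c) {xs = L} fv≰c))
                  (trans (count-≤≡below-map f c L) (sym (below-∷-≮ (map f L) (fv≰c ∘ s≤s⁻¹))))

-- Admissibility of dominating rows.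

module _ {N : ℕ} (rule : Rule N) where

  admissible : ∀ k ℓ (rows : Fin k → List ℕ) → (∀ a → length (rows a) ≡ ℓ) →
    (∀ a {x} → x ∈ rows a → x < N) →
    (∀ a a′ → toℕ a′ ≡ suc (toℕ a) → Dominates (rows a′) (rows a)) → Admissible rule k ℓ rows
  admissible zero ℓ rows len bounded dom = tt
  admissible (suc zero) ℓ rows len bounded dom = len zero , last-dominates , tt
    where
    last-dominates : Dominates (replicate ℓ N) (rows zero)
    -- Once `c` reaches `N` both counts equal `ℓ`; before that no copy of `N` is counted.
    last-dominates c with N ≤? c
    ... | yes N≤c = ≤-reflexive (trans (below-replicate-< ℓ (s≤s N≤c))
                      (sym (trans (below-all λ x∈ → <-≤-trans (bounded zero x∈) N≤c) (len zero))))
    ... | no N≰c = subst (_≤ below c (rows zero)) (sym (below-replicate-≥ ℓ (≰⇒> N≰c))) z≤n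
  admissible (suc k@(suc _)) ℓ rows len bounded dom =
    len zero , dom zero (suc zero) refl ,
    admissible k ℓ (rows ∘ suc) (len ∘ suc) (bounded ∘ suc) (λ a a′ eq → dom (suc a) (suc a′) (cong suc eq))

-- The rows of entries read off from the tableau.

module _ {k n : ℕ} (k<n : suc k < n) {T : Tableau (suc k) n} (isTableau : IsTableau (suc k) n T) where

  private
    cols : ℕ
    cols = n ∸ suc k

    1≤cols : 1 ≤ cols
    1≤cols = m<n⇒0<n∸m k<n

    k+cols≡n : suc k + cols ≡ n
    k+cols≡n = m+[n∸m]≡n (<⇒≤ k<n)

    suc-pred-cols : suc (cols ∸ 1) ≡ cols
    suc-pred-cols = m+[n∸m]≡n 1≤cols

    lastColumn : Fin cols
    lastColumn = fromℕ< (≤-reflexive suc-pred-cols)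

    lastColumn≡ : suc (toℕ lastColumn) ≡ cols
    lastColumn≡ = trans (cong suc (toℕ-fromℕ< (≤-reflexive suc-pred-cols))) suc-pred-cols

    ℓ : ℕ
    ℓ = T zero lastColumn

    -- Climb the column to the first row, then move right to the last column.
    T≤ℓ : ∀ a b → T a b ≤ ℓ
    T≤ℓ a b = ≤-trans
      (steps⇒related {_~_ = _≥_} ≤-refl (flip ≤-trans) (λ a → T a b) (λ a a′ → proj₂ isTableau a a′ b) zero a z≤n)
      (steps⇒related {_~_ = _≤_} ≤-refl ≤-trans (T zero) (proj₁ isTableau zero) b lastColumn
        (s≤s⁻¹ (subst (suc (toℕ b) ≤_) (sym lastColumn≡) (toℕ<n b))))

    -- The number of entries < c in row a, so that the count of t_ab sits at c = a + b + 2 for 0-based a, b.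
    rowCount : Fin (suc k) → ℕ → ℕ
    rowCount a = delay (2 + toℕ a) (extendBy ℓ (T a))

    rowCount-step : ∀ a c → rowCount a c ≤ rowCount a (suc c)
    rowCount-step a = delay-step (2 + toℕ a) (extendBy-step (T a) (proj₁ isTableau a) (T≤ℓ a))

    rowCount-entry : ∀ a b → rowCount a (2 + (toℕ a + toℕ b)) ≡ T a b
    rowCount-entry a b = trans (delay-+ (2 + toℕ a) _ (toℕ b)) (extendBy-toℕ (T a) b)

    rowCount-≥ : ∀ a b → cols ≤ b → rowCount a (2 + (toℕ a + b)) ≡ ℓ
    rowCount-≥ a b cols≤b = trans (delay-+ (2 + toℕ a) _ b) (extendBy-≥ (T a) cols≤b)

    2+a+cols≤1+n : ∀ (a : Fin (suc k)) → 2 + (toℕ a + cols) ≤ suc n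
    2+a+cols≤1+n a = s≤s (subst (suc (toℕ a) + cols ≤_) k+cols≡n (+-monoˡ-≤ cols (toℕ<n a)))

    rowCount->n : ∀ a c → suc n ≤ c → rowCount a c ≡ ℓ
    rowCount->n a c n<c = trans (cong (rowCount a) (sym c≡)) (rowCount-≥ a (c ∸ (2 + toℕ a)) cols≤)
      where
      a+cols≤c : 2 + toℕ a + cols ≤ c
      a+cols≤c = ≤-trans (2+a+cols≤1+n a) n<c
      c≡ : 2 + (toℕ a + (c ∸ (2 + toℕ a))) ≡ c
      c≡ = m+[n∸m]≡n (m+n≤o⇒m≤o (2 + toℕ a) a+cols≤c)
      cols≤ : cols ≤ c ∸ (2 + toℕ a)
      cols≤ = m+n≤o⇒m≤o∸n cols (subst (_≤ c) (+-comm (2 + toℕ a) cols) a+cols≤c)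

    rows : Fin (suc k) → List ℕ
    rows a = withCounts (rowCount a) refl (rowCount-step a) (suc n)

    length-rows : ∀ a → length (rows a) ≡ ℓ
    length-rows a = trans (length-withCounts (rowCount a) refl (rowCount-step a) (suc n)) (rowCount->n a (suc n) ≤-refl)

    below-rows : ∀ a c → below c (rows a) ≡ rowCount a c
    below-rows a c = trans (below-withCounts (rowCount a) refl (rowCount-step a) (suc n) c) cap
      where
      cap : rowCount a (c ⊓ suc n) ≡ rowCount a c
      cap with ≤-total c (suc n)
      ... | inj₁ c≤ = cong (rowCount a) (m≤n⇒m⊓n≡m c≤)
      ... | inj₂ n<c = trans (cong (rowCount a) (m≥n⇒m⊓n≡n n<c))
                         (trans (rowCount->n a (suc n) ≤-refl) (sym (rowCount->n a c n<c)))

    rows-bounded : ∀ a {x} → x ∈ rows a → x < suc n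
    rows-bounded a = below-all⁻
      (trans (below-rows a (suc n)) (trans (rowCount->n a (suc n) ≤-refl) (sym (length-rows a))))

    rows-dominate : ∀ a a′ → toℕ a′ ≡ suc (toℕ a) → Dominates (rows a′) (rows a)
    rows-dominate a a′ a′≡ c =
      -- Row `a′` is delayed by one more step, so its count at `suc c` reduces to the same column
      -- that row `a` reads at `c`.
      subst₂ _≤_ (trans (cong (λ i → delay (2 + i) (extendBy ℓ (T a′)) (suc c)) (sym a′≡)) (sym (below-rows a′ (suc c))))
        (sym (below-rows a c))
        (delay-mono (2 + toℕ a) (extendBy-mono (λ b → proj₂ isTableau a a′ b a′≡)) c)

    -- The count in the first row is already `ℓ` at `suc cols`. This keeps out the top vector, whose
    -- first entry is `cols + 1`.
    firstRow≤ : ∀ {x} → x ∈ rows zero → x ≤ cols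
    firstRow≤ x∈ = s≤s⁻¹ (below-all⁻ (trans (below-rows zero (suc cols)) (trans count≡ℓ (sym (length-rows zero)))) x∈)
      where
      count≡ℓ : rowCount zero (suc cols) ≡ ℓ
      count≡ℓ = trans (cong (rowCount zero ∘ suc) (sym lastColumn≡)) (rowCount-entry zero lastColumn)

  -- Solutions for the tableau coincide with realizations of its rows.

  module _ (rule : Rule (suc n)) where
    open Rule rule

    private
      realizes⇒good : ∀ {L} → Realizes rule rows ℓ L → Good (suc k) n (R (suc k)) T L
      realizes⇒good {L} (_ , perm , inc , pw) = inV* , summing≡ , pw
        where
        entry∈ : ∀ {v} a → v ∈ L → lookup v a ∈ rows a
        entry∈ a v∈ = ∈-resp-↭ (perm a) (∈-map⁺ (λ v → lookup v a) v∈)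
        inV* : ∀ v → v ∈ L → InV* (suc k) n v
        inV* v v∈ =
          -- `rowCount a 1` computes to 0, so every entry is at least 1.
          ((λ a → below-none⁻ (below-rows a 1) (entry∈ a v∈) , s≤s⁻¹ (lookup<bound (inc v∈) a)) ,
           lookup-mono-< (inc v∈)) ,
          λ top → ≤⇒≯ (firstRow≤ (entry∈ zero v∈)) (≤-reflexive (sym (trans (top zero) (+-comm cols 1))))
        summing≡ : ∀ a b → summing (suc k) n L a b ≡ T a b
        summing≡ a b = begin
          summing (suc k) n L a b                   ≡⟨ count-≤≡below-map (λ v → lookup v a) c L ⟩
          below (suc c) (map (λ v → lookup v a) L)  ≡⟨ below-↭ (suc c) (perm a) ⟩
          below (suc c) (rows a)                    ≡⟨ below-rows a (suc c) ⟩
          rowCount a (suc c)                        ≡⟨ rowCount-entry a b ⟩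
          T a b                                     ∎
          where
          open ≡-Reasoning
          c = suc (toℕ a + toℕ b)

      module _ {L : List (Vec ℕ (suc k))} (good : Good (suc k) n (R (suc k)) T L) where

        inc : ∀ {v} → v ∈ L → Increasing (suc n) v
        inc {v} v∈ with (range , mono) , _ ← proj₁ good v v∈ =
          increasing v (λ a → s≤s (proj₂ (range a))) mono

        entry> : ∀ {v} a → v ∈ L → toℕ a < lookup v a
        entry> {x ∷ v} a v∈ with (range , _) , _ ← proj₁ good (x ∷ v) v∈ =
          ≤-trans (+-monoˡ-≤ (toℕ a) (proj₁ (range zero))) (hd+index≤lookup (inc v∈) a)

        entry≤ : ∀ {v} a → v ∈ L → lookup v a ≤ cols + suc (toℕ a)
        entry≤ {v} a v∈ = +-cancelʳ-≤ (suc k) _ _ (subst (lookup v a + suc k ≤_) rearrange (lookup+length≤bound+index (inc v∈) a))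
          where
          rearrange : suc n + toℕ a ≡ cols + suc (toℕ a) + suc k
          rearrange = begin
            suc n + toℕ a                 ≡⟨ sym (+-suc n (toℕ a)) ⟩
            n + suc (toℕ a)               ≡⟨ cong (_+ suc (toℕ a)) (trans (sym k+cols≡n) (+-comm (suc k) cols)) ⟩
            cols + suc k + suc (toℕ a)    ≡⟨ +-assoc cols (suc k) (suc (toℕ a)) ⟩
            cols + (suc k + suc (toℕ a))  ≡⟨ cong (cols +_) (+-comm (suc k) (suc (toℕ a))) ⟩
            cols + (suc (toℕ a) + suc k)  ≡⟨ sym (+-assoc cols (suc (toℕ a)) (suc k)) ⟩
            cols + suc (toℕ a) + suc k    ∎
            where open ≡-Reasoning

        -- A first entry beyond `cols` forces every later entry up to its maximal value, which makes
        -- the vector the excluded top one.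
        first≤ : ∀ {v} → v ∈ L → lookup v zero ≤ cols
        first≤ {x ∷ v} v∈ with x ≤? cols
        ... | yes x≤cols = x≤cols
        ... | no x≰cols = contradiction top (proj₂ (proj₁ good (x ∷ v) v∈))
          where
          top : IsTop (suc k) n (x ∷ v)
          top a = ≤-antisym (entry≤ a v∈)
            (subst (_≤ lookup (x ∷ v) a) (sym (+-suc cols (toℕ a)))
              (≤-trans (+-monoˡ-≤ (toℕ a) (≰⇒> x≰cols)) (hd+index≤lookup (inc v∈) a)))

        column : Fin (suc k) → List ℕ
        column a = map (λ v → lookup v a) L

        column-All : ∀ {Q : ℕ → Set} a → (∀ {v} → v ∈ L → Q (lookup v a)) → ∀ {x} → x ∈ column a → Q x
        column-All {Q} a q x∈ = let v , v∈ , x≡ = ∈-map⁻ (λ v → lookup v a) x∈ in subst Q (sym x≡) (q v∈)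

        below-column-entry : ∀ a b → below (2 + (toℕ a + toℕ b)) (column a) ≡ T a b
        below-column-entry a b =
          trans (sym (count-≤≡below-map (λ v → lookup v a) (suc (toℕ a + toℕ b)) L)) (proj₁ (proj₂ good) a b)

        length≡ℓ : length L ≡ ℓ
        length≡ℓ = begin
          length L                                  ≡⟨ sym (length-map _ L) ⟩
          length (column zero)                      ≡⟨ sym (below-all (column-All zero (s≤s ∘ first≤))) ⟩
          below (suc cols) (column zero)            ≡⟨ cong (λ m → below (suc m) (column zero)) (sym lastColumn≡) ⟩
          below (2 + toℕ lastColumn) (column zero)  ≡⟨ below-column-entry zero lastColumn ⟩
          ℓ                                         ∎
          where open ≡-Reasoning

        -- Three ranges of `c`: up to `a + 1` nothing is counted, next come the columns of the
        -- tableau, and past them every vector is counted. Hence `T` determines all counts.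
        below-column : ∀ a c → below c (column a) ≡ rowCount a c
        below-column a c with c <? 2 + toℕ a
        ... | yes (s≤s c≤) = trans (below-none (column-All a λ v∈ → ≤-trans c≤ (entry> a v∈)))
                               (sym (delay-< _ (s≤s c≤)))
        ... | no c≮ = subst (λ c → below c (column a) ≡ rowCount a c) (m+[n∸m]≡n (≮⇒≥ c≮)) (at (c ∸ (2 + toℕ a)))
          where
          at : ∀ b → below (2 + (toℕ a + b)) (column a) ≡ rowCount a (2 + (toℕ a + b))
          at b with b <? cols
          ... | yes b<cols = subst (λ b → below (2 + (toℕ a + b)) (column a) ≡ rowCount a (2 + (toℕ a + b)))
                  (toℕ-fromℕ< b<cols)
                  (trans (below-column-entry a (fromℕ< b<cols)) (sym (rowCount-entry a (fromℕ< b<cols))))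
          ... | no b≮cols = trans (below-all (column-All a bound))
                  (trans (trans (length-map _ L) length≡ℓ) (sym (rowCount-≥ a b (≮⇒≥ b≮cols))))
            where
            bound : ∀ {v} → v ∈ L → lookup v a < 2 + (toℕ a + b)
            bound v∈ = s≤s (≤-trans (entry≤ a v∈)
              (≤-trans (≤-reflexive (+-comm cols (suc (toℕ a)))) (+-monoʳ-≤ (suc (toℕ a)) (≮⇒≥ b≮cols))))

        good⇒realizes : Realizes rule rows ℓ L
        good⇒realizes =
          length≡ℓ ,
          (λ a → below-injective (column a) (rows a) (λ c → trans (below-column a c) (sym (below-rows a c)))) ,
          inc , proj₂ (proj₂ good)

    uniqueMultiset : UniqueMultiset (Good (suc k) n (R (suc k)) T)
    uniqueMultiset = L , realizes⇒good (proj₁ realizes) , λ L′ good → proj₂ realizes L′ (good⇒realizes good)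
      where
      solution : ∃ λ L → Realizes rule rows ℓ L × (∀ L′ → Realizes rule rows ℓ L′ → L′ ↭ L)
      solution = realizes-unique-exists rule (suc k) ℓ rows
        (admissible rule (suc k) ℓ rows length-rows rows-bounded rows-dominate)
      L = proj₁ solution
      realizes = proj₂ solution

theorem2p3 : (k n : ℕ) → 1 ≤ k → k < n → (T : Tableau k n) → IsTableau k n T →
    UniqueMultiset (Good k n (Nonnesting k) T) × UniqueMultiset (Good k n (Noncrossing k) T)
theorem2p3 (suc k) n _ k<n T isTableau =
  uniqueMultiset k<n isTableau (nonnestingRule (suc n)) ,
  uniqueMultiset k<n isTableau (noncrossingRule (suc n))
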